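{- Let $K$ be a simplicial complex and $f\colon K\to\mathbb{Z}$ a Morse function on $K$. Then there exists a Morse sequence $\overrightarrow{W}$ on $K$ such that $f$ is a Morse function on $\overrightarrow{W}$. Furthermore, any Morse function on $\overrightarrow{W}$ is equivalent to $f$.
   Context: A simplicial complex $K$ is a finite collection of non-empty finite sets closed under taking non-empty subsets; for a simplex $\tau$, $\partial(\tau)$ is the set of simplices $\sigma\subset\tau$ of $K$ with $\dim\sigma=\dim\tau-1$ (where $\dim\sigma=|\sigma|-1$). A pair $(\sigma,\tau)$ with $\sigma\subsetneq\tau$ is a free pair for $K$ if $\tau$ is the only simplex other than $\sigma$ containing $\sigma$; $K$ is then an elementary expansion of $K\setminus\{\sigma,\tau\}$. If $\nu$ is a facet (maximal simplex) of $K$, $K$ is an elementary filling of $K\setminus\{\nu\}$. A Morse sequence on $K$ is a sequence $\langle\emptyset=K_0,\dots,K_k=K\rangle$ with each $K_i$ an elementary expansion or filling of $K_{i-1}$; set $\kappa_i=\nu$ if $K_i=K_{i-1}\cup\{\nu\}$ is a filling ($\nu$ critical), and $\kappa_i=(\sigma,\tau)$ if $K_i=K_{i-1}\cup\{\sigma,\tau\}$ is an expansion with $\sigma\subset\tau$ (a regular pair). A map $f\colon K\to\mathbb{Z}$ is a Morse function on $K$ if, letting $V_f$ be the set of all pairs $(\sigma,\tau)$ with $\sigma\in\partial(\tau)$ and $f(\sigma)\ge f(\tau)$, each simplex of $K$ lies in at most one pair of $V_f$; $V_f$ is the gradient vector field of $f$, and two Morse functions on $K$ are equivalent if they have the same gradient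 vector field. A map $f\colon K\to\mathbb{Z}$ is a Morse function on a Morse sequence $\overrightarrow{W}$ if (1) whenever $\kappa_i$ is a critical simplex and $\nu\in\partial(\kappa_i)$, $f(\kappa_i)>f(\nu)$; and (2) whenever $\kappa_i=(\sigma,\tau)$ is a regular pair, $f(\sigma)\ge f(\tau)$.
   Formalization: In the last sentence, "any Morse function on W" is taken to mean any Morse function on K that is also a Morse function on W; without this the claim fails, e.g. on a single edge, since conditions (1) and (2) alone do not make a map a Morse function on K. -}

module Defs where

open import Data.Empty using (⊥)
open import Data.Fin.Subset using (Subset; Nonempty; ∣_∣; _⊆_; _⊂_)
open import Data.Integer using (ℤ; +_; _-_; 1ℤ; _≥_; _>_)
open import Data.Nat using (ℕ)
open import Data.Product using (_×_; _,_; proj₁; proj₂)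
open import Data.Sum using (_⊎_; inj₁; inj₂)
open import Level using (0ℓ)
open import Relation.Binary.PropositionalEquality using (_≡_)
open import Relation.Unary using (Pred; Decidable; Empty; ｛_｝; _∪_; _∖_; _≐_)

-- A finite complex has finitely many vertices, so its simplices are taken to
-- be subsets of Fin n; elements of Fin n need not be vertices of the complex.
-- Finiteness of the collection is automatic, and decidability of membership
-- expresses that it is a finite set in the classical sense.

record SimplicialComplex (n : ℕ) : Set₁ where
  field
    Simplex  : Pred (Subset n) 0ℓ
    simplex? : Decidable Simplex
    nonempty : ∀ {σ} → Simplex σ → Nonempty σ
    closed   : ∀ {σ τ} → Simplex τ → σ ⊆ τ → Nonempty σ → Simplex σ

open SimplicialComplex public

dim : ∀ {n} → Subset n → ℤ
dim σ = + ∣ σ ∣ - 1ℤ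

-- Membership is an irrelevant component, so a map out of Face K depends only
-- on the underlying simplex.

record Face {n} (K : SimplicialComplex n) : Set where
  constructor face
  field
    value    : Subset n
    .value∈K : Simplex K value

open Face public

∂ : ∀ {n} {K : SimplicialComplex n} → Face K → Pred (Face K) 0ℓ
∂ τ σ = value σ ⊆ value τ × dim (value σ) ≡ dim (value τ) - 1ℤ

record IsFreePair {n} (K : SimplicialComplex n) (σ τ : Subset n) : Set where
  field
    σ∈K  : Simplex K σ
    τ∈K  : Simplex K τ
    σ⊂τ  : σ ⊂ τ
    only : ∀ {ρ} → Simplex K ρ → σ ⊆ ρ → ρ ≡ σ ⊎ ρ ≡ τ

record IsFacet {n} (K : SimplicialComplex n) (ν : Subset n) : Set where
  field
    ν∈K     : Simplex K ν
    maximal : ∀ {ρ} → Simplex K ρ → ν ⊆ ρ → ρ ≡ ν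

-- K is an elementary expansion, respectively filling, of L.

record ElementaryExpansion {n} (L K : SimplicialComplex n) : Set where
  field
    σ τ     : Subset n
    free    : IsFreePair K σ τ
    removal : Simplex L ≐ Simplex K ∖ (｛ σ ｝ ∪ ｛ τ ｝)

record ElementaryFilling {n} (L K : SimplicialComplex n) : Set where
  field
    ν       : Subset n
    facet   : IsFacet K ν
    removal : Simplex L ≐ Simplex K ∖ ｛ ν ｝

infixl 5 _▷_

data MorseSequence {n : ℕ} : SimplicialComplex n → Set₁ where
  start : ∀ {K} → Empty (Simplex K) → MorseSequence K
  _▷_   : ∀ {L K} → MorseSequence L →
          ElementaryExpansion L K ⊎ ElementaryFilling L K → MorseSequence K

-- ν is κᵢ for some i.

IsCritical : ∀ {n} {K : SimplicialComplex n} →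
             MorseSequence K → Subset n → Set
IsCritical (start _)    ν = ⊥
IsCritical (W ▷ inj₁ _) ν = IsCritical W ν
IsCritical (W ▷ inj₂ φ) ν = ν ≡ ElementaryFilling.ν φ ⊎ IsCritical W ν

-- (σ , τ) is κᵢ for some i.

IsRegularPair : ∀ {n} {K : SimplicialComplex n} →
                MorseSequence K → Subset n → Subset n → Set
IsRegularPair (start _)    σ τ = ⊥
IsRegularPair (W ▷ inj₁ ε) σ τ =
  (σ ≡ ElementaryExpansion.σ ε × τ ≡ ElementaryExpansion.τ ε)
    ⊎ IsRegularPair W σ τ
IsRegularPair (W ▷ inj₂ _) σ τ = IsRegularPair W σ τ

-- The set V_f.

V : ∀ {n} {K : SimplicialComplex n} →
    (Face K → ℤ) → Pred (Face K × Face K) 0ℓ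
V f (σ , τ) = ∂ τ σ × f σ ≥ f τ

_liesIn_ : ∀ {A : Set} → A → A × A → Set
ρ liesIn p = ρ ≡ proj₁ p ⊎ ρ ≡ proj₂ p

record MorseFunction {n} (K : SimplicialComplex n) : Set where
  field
    map       : Face K → ℤ
    atMostOne : ∀ ρ {p q} → V map p → V map q →
                ρ liesIn p → ρ liesIn q → p ≡ q

open MorseFunction public

Equivalent : ∀ {n} {K : SimplicialComplex n} →
             MorseFunction K → MorseFunction K → Set
Equivalent f g = V (map f) ≐ V (map g)

-- These two conditions alone do not make f a Morse function on K: they do not
-- bound f on the faces of τ other than σ when (σ , τ) is a regular pair.

record IsMorseOn {n} {K : SimplicialComplex n}
                 (W : MorseSequence K) (f : Face K → ℤ) : Set where
  field
    critical : ∀ κ ν → IsCritical W (value κ) → ∂ κ ν → f κ > f ν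
    regular  : ∀ σ τ → IsRegularPair W (value σ) (value τ) → f σ ≥ f τ

{-# OPTIONS --safe #-}

-- Peel K from the top. In a nonempty subcomplex closed under V_f-partners, take
-- a face ρ maximising f, replaced by its lower partner if it is the upper face
-- of a pair (the lower partner also maximises f). Every coface of ρ of codimension
-- one has value at most f ρ, so it is a V_f-partner of ρ, and there is at most one.
-- If there is none, ρ is a facet lying in no pair; otherwise ρ and its partner form
-- a free pair. Either way the removal leaves a subcomplex closed under partners.
-- The sequence obtained covers each simplex by a critical simplex or a pair of
-- V_f, and this determines the gradient field of any Morse function on it.

module Submission where

open import Defs
open import Data.Nat using (ℕ)
open import Data.Product using (Σ-syntax; _×_)

open import Data.Bool.Properties using () renaming (_≟_ to _≟ᵇ_)
open import Data.Fin using (Fin; zero; suc)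
open import Data.Fin.Subset using (Subset; inside; outside; ⁅_⁆; ∣_∣; _∈_; _∉_; _⊆_; _⊂_) renaming (_∪_ to _∪ˢ_)
open import Data.Fin.Subset.Properties using (_∈?_; _⊆?_; ⊆-antisym; ⊆-trans; p⊆p∪q; q⊆p∪q; x∈p∪q⁻; x∈⁅x⁆; x∈⁅y⁆⇒x≡y; ∪-identityʳ)
open import Data.Integer as ℤ using (ℤ; 1ℤ)
import Data.Integer.Properties as ℤ
open import Data.List using (List; []; _∷_; _++_; concatMap; filter; length) renaming (map to mapᴸ)
open import Data.List.Extrema ℤ.≤-totalOrder using (argmax; argmax-all; f[⊥]≤f[argmax]; f[xs]≤f[argmax])
open import Data.List.Membership.Propositional using (find; lose) renaming (_∈_ to _∈ᴸ_)
open import Data.List.Membership.Propositional.Properties using (∈-concatMap⁺; ∈-filter⁺; ∈-filter⁻; ∈-map⁺; ∈-++⁺ˡ; ∈-++⁺ʳ)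
open import Data.List.Properties using (filter-notAll)
import Data.List.Relation.Unary.All as All
open import Data.List.Relation.Unary.Any as Any using (here; there)
import Data.Nat as ℕ
open import Data.Nat.Induction using (<-wellFounded)
open import Data.Product using (∃-syntax; ∃₂; _,_; proj₁; proj₂)
open import Data.Sum as Sum using (_⊎_; inj₁; inj₂)
open import Data.Vec using ([]; _∷_; here; there)
open import Data.Vec.Properties using (≡-dec)
open import Data.Fin.Properties using (any?)
open import Function using (_∘_; id)
open import Induction.WellFounded using (Acc; acc)
open import Level using (0ℓ)
open import Relation.Binary.PropositionalEquality using (_≡_; refl; sym; trans; cong; subst)
open import Relation.Nullary using (Dec; yes; no; ¬_; ¬?; contradiction; recompute; _×-dec_; _⊎-dec_)
open import Relation.Unary using (Pred; Decidable; Empty; ｛_｝; _∪_; _∖_)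

-- Subsets of `Fin n`: adding a point, strict inclusion, enumeration.

∣p∪⁅x⁆∣≡1+∣p∣ : ∀ {n} (p : Subset n) {x} → x ∉ p → ∣ p ∪ˢ ⁅ x ⁆ ∣ ≡ ℕ.suc ∣ p ∣
∣p∪⁅x⁆∣≡1+∣p∣ (inside  ∷ p) {zero}  x∉p = contradiction here x∉p
∣p∪⁅x⁆∣≡1+∣p∣ (outside ∷ p) {zero}  x∉p = cong (ℕ.suc ∘ ∣_∣) (∪-identityʳ p)
∣p∪⁅x⁆∣≡1+∣p∣ (inside  ∷ p) {suc x} x∉p = cong ℕ.suc (∣p∪⁅x⁆∣≡1+∣p∣ p (x∉p ∘ there))
∣p∪⁅x⁆∣≡1+∣p∣ (outside ∷ p) {suc x} x∉p = ∣p∪⁅x⁆∣≡1+∣p∣ p (x∉p ∘ there)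

⊆⇒⊂⊎≡ : ∀ {n} {p q : Subset n} → p ⊆ q → p ⊂ q ⊎ p ≡ q
⊆⇒⊂⊎≡ {p = p} {q} p⊆q with any? (λ x → (x ∈? q) ×-dec ¬? (x ∈? p))
... | yes x∈q∖p = inj₁ (p⊆q , x∈q∖p)
... | no  q∖p≡∅ = inj₂ (⊆-antisym p⊆q q⊆p)
  where
  q⊆p : q ⊆ p
  q⊆p {x} x∈q with x ∈? p
  ... | yes x∈p = x∈p
  ... | no  x∉p = contradiction (x , x∈q , x∉p) q∖p≡∅

_≟ˢ_ : ∀ {n} (p q : Subset n) → Dec (p ≡ q)
_≟ˢ_ = ≡-dec _≟ᵇ_

allSubsets : ∀ n → List (Subset n)
allSubsets ℕ.zero    = [] ∷ []
allSubsets (ℕ.suc n) = mapᴸ (inside ∷_) (allSubsets n) ++ mapᴸ (outside ∷_) (allSubsets n)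

∈-allSubsets : ∀ {n} (p : Subset n) → p ∈ᴸ allSubsets n
∈-allSubsets []            = here refl
∈-allSubsets (inside  ∷ p) = ∈-++⁺ˡ (∈-map⁺ _ (∈-allSubsets p))
∈-allSubsets (outside ∷ p) = ∈-++⁺ʳ _ (∈-map⁺ _ (∈-allSubsets p))

-- Subcomplexes obtained by deleting upward closed sets of simplices.

remove : ∀ {n} (L : SimplicialComplex n) {D : Pred (Subset n) 0ℓ} → Decidable D →
         (∀ {σ τ} → D σ → Simplex L τ → σ ⊆ τ → D τ) → SimplicialComplex n
remove L {D} D? upward = record
  { Simplex  = Simplex L ∖ D
  ; simplex? = λ σ → simplex? L σ ×-dec ¬? (D? σ)
  ; nonempty = nonempty L ∘ proj₁
  ; closed   = λ (τ∈L , ¬Dτ) σ⊆τ ne →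
                 closed L τ∈L σ⊆τ ne , λ Dσ → ¬Dτ (upward Dσ τ∈L σ⊆τ)
  }

-- Whatever contains `τ` also contains `σ`, so `only` settles both cases.
freePair-upward : ∀ {n} {L : SimplicialComplex n} {σ τ} → IsFreePair L σ τ →
                  ∀ {α β} → (｛ σ ｝ ∪ ｛ τ ｝) α → Simplex L β → α ⊆ β → (｛ σ ｝ ∪ ｛ τ ｝) β
freePair-upward free (inj₁ refl) β∈L α⊆β =
  Sum.map sym sym (IsFreePair.only free β∈L α⊆β)
freePair-upward free (inj₂ refl) β∈L α⊆β =
  Sum.map sym sym (IsFreePair.only free β∈L (⊆-trans (proj₁ (IsFreePair.σ⊂τ free)) α⊆β))

facet-upward : ∀ {n} {L : SimplicialComplex n} {ν} → IsFacet L ν →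
               ∀ {α β} → ｛ ν ｝ α → Simplex L β → α ⊆ β → ｛ ν ｝ β
facet-upward facet refl β∈L α⊆β = sym (IsFacet.maximal facet β∈L α⊆β)

-- Faces of `K`, their incidence, and finite listings of them.

module _ {n : ℕ} {K : SimplicialComplex n} where

  -- The stored membership is irrelevant; decidability of `Simplex K` recovers a usable proof.
  value∈ : (ρ : Face K) → Simplex K (value ρ)
  value∈ (face σ σ∈K) = recompute (simplex? K σ) σ∈K

  value-injective : {σ τ : Face K} → value σ ≡ value τ → σ ≡ τ
  value-injective refl = refl

  ∂⇒⊂ : {σ τ : Face K} → ∂ τ σ → value σ ⊂ value τ
  ∂⇒⊂ {σ} {τ} (σ⊆τ , dimσ) with ⊆⇒⊂⊎≡ σ⊆τ
  ... | inj₁ σ⊂τ = σ⊂τ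
  ... | inj₂ σ≡τ = contradiction (trans (cong dim (sym σ≡τ)) dimσ) (i≢i-1 (dim (value τ)))
    where
    i≢i-1 : ∀ i → ¬ i ≡ i ℤ.- 1ℤ
    i≢i-1 i eq = ℤ.<-irrefl refl (ℤ.i≤pred[j]⇒i<j (ℤ.≤-reflexive (trans eq (ℤ.+-comm i ℤ.-1ℤ))))

  ∂-insert : {σ τ : Face K} {x : Fin n} → x ∉ value σ → value τ ≡ value σ ∪ˢ ⁅ x ⁆ → ∂ τ σ
  ∂-insert {σ} {τ} {x} x∉σ refl =
    p⊆p∪q ⁅ x ⁆ , sym (cong (λ k → ℤ.+ k ℤ.- 1ℤ ℤ.- 1ℤ) (∣p∪⁅x⁆∣≡1+∣p∣ (value σ) x∉σ))

  -- The entries are faces of the ambient `K`, so f applies to them directly. A listing makes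
  -- searches through `L` decidable, and its length measures the peeling recursion.
  record Listing (L : SimplicialComplex n) (xs : List (Face K)) : Set where
    field
      complete : ∀ {ρ} → Simplex L (value ρ) → ρ ∈ᴸ xs
      sound    : ∀ {ρ} → ρ ∈ᴸ xs → Simplex L (value ρ)

  listing : ∃[ xs ] Listing K xs
  listing = concatMap facesAt (allSubsets n) , record
    { complete = λ {ρ} ρ∈K → ∈-concatMap⁺ facesAt (lose (∈-allSubsets (value ρ)) (∈-facesAt ρ ρ∈K))
    ; sound    = λ {ρ} _ → value∈ ρ
    }
    where
    facesAt : Subset n → List (Face K)
    facesAt σ with simplex? K σ
    ... | yes σ∈K = face σ σ∈K ∷ []
    ... | no  _   = []

    ∈-facesAt : ∀ ρ → Simplex K (value ρ) → ρ ∈ᴸ facesAt (value ρ)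
    ∈-facesAt ρ ρ∈K with simplex? K (value ρ)
    ... | yes _   = here refl
    ... | no  ρ∉K = contradiction ρ∈K ρ∉K

  listing-remove : ∀ {L xs} {D : Pred (Subset n) 0ℓ} (D? : Decidable D) →
                   (upward : ∀ {σ τ} → D σ → Simplex L τ → σ ⊆ τ → D τ) → Listing L xs →
                   Listing (remove L D? upward) (filter (¬? ∘ D? ∘ value) xs)
  listing-remove D? _ l = record
    { complete = λ (ρ∈L , ¬Dρ) → ∈-filter⁺ (¬? ∘ D? ∘ value) (Listing.complete l ρ∈L) ¬Dρ
    ; sound    = λ ρ∈ → let ρ∈xs , ¬Dρ = ∈-filter⁻ (¬? ∘ D? ∘ value) ρ∈
                        in Listing.sound l ρ∈xs , ¬Dρ
    }

  V? : (f : Face K → ℤ) → Decidable (V f)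
  V? f (σ , τ) =
    ((value σ ⊆? value τ) ×-dec (dim (value σ) ℤ.≟ dim (value τ) ℤ.- 1ℤ)) ×-dec (f τ ℤ.≤? f σ)

  V-irreflexive : (f : Face K → ℤ) {σ : Face K} → ¬ V f (σ , σ)
  V-irreflexive f {σ} (σ∈∂σ , _) with ∂⇒⊂ {σ} {σ} σ∈∂σ
  ... | _ , _ , x∈σ , x∉σ = x∉σ x∈σ

  -- Maximisers of f in a partner-closed subcomplex.

  module _ (f : MorseFunction K) where

    private
      Vf : Pred (Face K × Face K) 0ℓ
      Vf = V (map f)

    -- Closure is a condition on upper partners; a lower partner is a nonempty face, so `lower`
    -- comes from `closed`.
    record PartnerClosed (L : SimplicialComplex n) : Set where
      field
        inK   : ∀ {σ} → Simplex L σ → Simplex K σ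
        upper : ∀ {σ τ} → Vf (σ , τ) → Simplex L (value σ) → Simplex L (value τ)

      lower : ∀ {σ τ} → Vf (σ , τ) → Simplex L (value τ) → Simplex L (value σ)
      lower {σ} ((σ⊆τ , _) , _) τ∈L = closed L τ∈L σ⊆τ (nonempty K (value∈ σ))

    Maximises : SimplicialComplex n → Pred (Face K) 0ℓ
    Maximises L ρ = ∀ {τ} → Simplex L (value τ) → map f τ ℤ.≤ map f ρ

    -- The conditions on `Vf` keep the remaining complex partner-closed and make the recorded step
    -- agree with the gradient field.
    data Removable (L : SimplicialComplex n) : Set where
      facet    : ∀ ν → IsFacet L (value ν) →
                 (∀ {p} → Vf p → ¬ ν liesIn p) → Removable L
      freePair : ∀ σ τ → IsFreePair L (value σ) (value τ) →
                 Vf (σ , τ) → Removable L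

    -- Adding one vertex of `ω` to `ρ` gives a simplex between the two, hence in `L`, and maximality
    -- of f at `ρ` makes it a partner. Simplices of any dimension above `ρ` are thus controlled in
    -- codimension one.
    coface-partner : ∀ {L} → PartnerClosed L → ∀ {ρ} → Maximises L ρ →
                     ∀ {ω x} → Simplex L ω → value ρ ⊆ ω → x ∈ ω → x ∉ value ρ →
                     ∃[ τ ] value τ ≡ value ρ ∪ˢ ⁅ x ⁆ × Vf (ρ , τ)
    coface-partner {L} cl {ρ} max {ω} {x} ω∈L ρ⊆ω x∈ω x∉ρ =
      τ , refl , ∂-insert {ρ} {τ} x∉ρ refl , max {τ} τ∈L
      where
      τ⊆ω : value ρ ∪ˢ ⁅ x ⁆ ⊆ ω
      τ⊆ω y∈τ with x∈p∪q⁻ (value ρ) ⁅ x ⁆ y∈τ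
      ... | inj₁ y∈ρ = ρ⊆ω y∈ρ
      ... | inj₂ y∈x = subst (_∈ ω) (sym (x∈⁅y⁆⇒x≡y x y∈x)) x∈ω

      τ∈L : Simplex L (value ρ ∪ˢ ⁅ x ⁆)
      τ∈L = closed L ω∈L τ⊆ω (x , q⊆p∪q (value ρ) ⁅ x ⁆ (x∈⁅x⁆ x))

      τ : Face K
      τ = face (value ρ ∪ˢ ⁅ x ⁆) (PartnerClosed.inK cl τ∈L)

    -- A strictly larger simplex would produce an upper partner through `coface-partner`.
    unpaired-facet : ∀ {L} → PartnerClosed L → ∀ {ρ} → Simplex L (value ρ) → Maximises L ρ →
                     (∀ {τ} → ¬ Vf (ρ , τ)) → IsFacet L (value ρ)
    unpaired-facet cl {ρ} ρ∈L max ¬lower = record { ν∈K = ρ∈L ; maximal = maximal }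
      where
      maximal : ∀ {ω} → _ → value ρ ⊆ ω → ω ≡ value ρ
      maximal ω∈L ρ⊆ω with ⊆⇒⊂⊎≡ ρ⊆ω
      ... | inj₂ ρ≡ω = sym ρ≡ω
      ... | inj₁ (_ , _ , x∈ω , x∉ρ) =
        let _ , _ , v = coface-partner cl {ρ} max ω∈L ρ⊆ω x∈ω x∉ρ in contradiction v ¬lower

    -- Any vertex of `ω` outside `σ`, added to `σ`, gives an upper partner, which is `τ` by
    -- `atMostOne`. So all these vertices lie in `τ`, and a single one already forces `τ` to lie in
    -- `ω`.
    paired-free : ∀ {L} → PartnerClosed L → ∀ {σ τ} → Simplex L (value σ) → Maximises L σ →
                  Vf (σ , τ) → IsFreePair L (value σ) (value τ)
    paired-free {L} cl {σ} {τ} σ∈L max στ∈V = record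
      { σ∈K  = σ∈L
      ; τ∈K  = PartnerClosed.upper cl στ∈V σ∈L
      ; σ⊂τ  = ∂⇒⊂ {σ} {τ} (proj₁ στ∈V)
      ; only = only
      }
      where
      insert≡τ : ∀ {ω x} → Simplex L ω → value σ ⊆ ω → x ∈ ω → x ∉ value σ →
                 value τ ≡ value σ ∪ˢ ⁅ x ⁆
      insert≡τ ω∈L σ⊆ω x∈ω x∉σ
        with τ′ , τ′≡ , στ′∈V ← coface-partner cl {σ} max ω∈L σ⊆ω x∈ω x∉σ
        = trans (cong (value ∘ proj₂) (atMostOne f σ στ∈V στ′∈V (inj₁ refl) (inj₁ refl))) τ′≡

      only : ∀ {ω} → Simplex L ω → value σ ⊆ ω → ω ≡ value σ ⊎ ω ≡ value τ
      only {ω} ω∈L σ⊆ω with ⊆⇒⊂⊎≡ σ⊆ω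
      ... | inj₂ σ≡ω = inj₁ (sym σ≡ω)
      ... | inj₁ (_ , x , x∈ω , x∉σ) = inj₂ (⊆-antisym ω⊆τ τ⊆ω)
        where
        ω⊆τ : ω ⊆ value τ
        ω⊆τ {y} y∈ω with y ∈? value σ
        ... | yes y∈σ = proj₁ (proj₁ στ∈V) y∈σ
        ... | no  y∉σ = subst (y ∈_) (sym (insert≡τ ω∈L σ⊆ω y∈ω y∉σ))
                              (q⊆p∪q (value σ) ⁅ y ⁆ (x∈⁅x⁆ y))

        τ⊆ω : value τ ⊆ ω
        τ⊆ω {y} y∈τ with x∈p∪q⁻ (value σ) ⁅ x ⁆ (subst (y ∈_) (insert≡τ ω∈L σ⊆ω x∈ω x∉σ) y∈τ)
        ... | inj₁ y∈σ = σ⊆ω y∈σ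
        ... | inj₂ y∈x = subst (_∈ ω) (sym (x∈⁅y⁆⇒x≡y x y∈x)) x∈ω

    -- Existence of a removable facet or free pair.

    module _ {L : SimplicialComplex n} (cl : PartnerClosed L)
             {xs : List (Face K)} (l : Listing L xs) where
      open PartnerClosed cl
      open Listing l

      -- Upper partners of `ρ` stay in `L`, so a search through `xs` decides whether one exists;
      -- with `¬upper`, a failed search leaves `ρ` in no pair.
      maximum-removable : ∀ {ρ} → Simplex L (value ρ) → Maximises L ρ →
                          (∀ {σ} → ¬ Vf (σ , ρ)) → Removable L
      maximum-removable {ρ} ρ∈L max ¬upper with Any.any? (λ τ → V? (map f) (ρ , τ)) xs
      ... | yes paired with τ , _ , v ← find paired =
        freePair ρ τ (paired-free cl {ρ} {τ} ρ∈L max v) v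
      ... | no unpaired = facet ρ (unpaired-facet cl {ρ} ρ∈L max ¬lower)
        λ { v (inj₁ refl) → ¬lower v ; v (inj₂ refl) → ¬upper v }
        where
        ¬lower : ∀ {τ} → ¬ Vf (ρ , τ)
        ¬lower {τ} v = unpaired (lose (complete {τ} (upper v ρ∈L)) v)

    removable : ∀ {L x xs} → PartnerClosed L → Listing L (x ∷ xs) → Removable L
    removable {L} {x} {xs} cl l = go
      where
      open PartnerClosed cl
      open Listing l

      m : Face K
      -- The head `x` is the starting value of `argmax`; as it lies in `L`, so does the maximiser.
      m = argmax (map f) x xs

      m∈L : Simplex L (value m)
      m∈L = argmax-all (map f) (sound (here refl)) (All.tabulate (sound ∘ there))

      m-max : Maximises L m
      m-max {τ} τ∈L with complete {τ} τ∈L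
      ... | here refl  = f[⊥]≤f[argmax] {f = map f} x xs
      ... | there τ∈xs = All.lookup (f[xs]≤f[argmax] {f = map f} x xs) τ∈xs

      go : Removable L
      go with Any.any? (λ σ → V? (map f) (σ , m)) (x ∷ xs)
      ... | no unpaired = maximum-removable cl l m∈L m-max
        λ {σ} v → unpaired (lose (complete {σ} (lower v m∈L)) v)
      ... | yes paired with σ , σ∈xs , v ← find paired =
        maximum-removable cl l {σ} (sound σ∈xs)
          (λ {τ} τ∈L → ℤ.≤-trans (m-max {τ} τ∈L) (proj₂ v)) ¬upper
        where
        ¬upper : ∀ {ρ} → ¬ Vf (ρ , σ)
        -- `σ` would be the upper face of one pair and the lower face of another; identifying the
        -- two pairs makes `σ` its own partner.
        ¬upper v′ with refl ← atMostOne f σ v′ v (inj₂ refl) (inj₁ refl) = V-irreflexive (map f) v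

    -- Construction of the Morse sequence.

    record IsGradient {L : SimplicialComplex n} (W : MorseSequence L) : Set where
      field
        critical   : ∀ {σ τ} → IsCritical W (value τ) → ¬ Vf (σ , τ)
        regular    : ∀ {σ τ} → IsRegularPair W (value σ) (value τ) → Vf (σ , τ)
        -- This covering of all faces is what lets the sequence determine the gradient field.
        exhaustive : ∀ {τ} → Simplex L (value τ) → IsCritical W (value τ) ⊎
                     ∃₂ λ (α β : Face K) → IsRegularPair W (value α) (value β) × τ liesIn (α , β)

    -- The removed face occurs in the listing, so filtering strictly shortens it. The step peeled
    -- off first becomes the last step of the sequence.
    gradient-sequence : ∀ {L xs} → PartnerClosed L → Listing L xs →
                        Acc ℕ._<_ (length xs) → Σ[ W ∈ MorseSequence L ] IsGradient W
    gradient-sequence {L} {[]} cl l _ = start L-empty , record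
      { critical   = λ ()
      ; regular    = λ ()
      ; exhaustive = λ τ∈L → contradiction τ∈L (L-empty _)
      }
      where
      L-empty : Empty (Simplex L)
      L-empty σ σ∈L with () ← Listing.complete l {face σ (PartnerClosed.inK cl σ∈L)} σ∈L
    gradient-sequence {L} {xs@(_ ∷ _)} cl l (acc rec) with removable cl l
    ... | facet ν ν-facet ν-unpaired = W ▷ inj₂ filling , record
      { critical   = λ { (inj₁ τ≡ν) v → ν-unpaired v (inj₂ (value-injective (sym τ≡ν)))
                       ; (inj₂ c) → critical c }
      ; regular    = regular
      ; exhaustive = exhaustive′
      }
      where
      upward : ∀ {α β} → ｛ value ν ｝ α → Simplex L β → α ⊆ β → ｛ value ν ｝ β
      upward = facet-upward ν-facet

      D? : Decidable ｛ value ν ｝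
      D? = value ν ≟ˢ_

      L′ : SimplicialComplex n
      L′ = remove L D? upward

      cl′ : PartnerClosed L′
      cl′ = record
        { inK   = PartnerClosed.inK cl ∘ proj₁
        -- Since `ν` is the upper face of no pair, no remaining face loses its partner.
        ; upper = λ v (σ∈L , _) → PartnerClosed.upper cl v σ∈L ,
                    λ ν≡τ → ν-unpaired v (inj₂ (value-injective ν≡τ))
        }

      ih : Σ[ W ∈ MorseSequence L′ ] IsGradient W
      ih = gradient-sequence cl′ (listing-remove D? upward l)
             (rec (filter-notAll (¬? ∘ D? ∘ value) xs
                    (lose (Listing.complete l {ν} (IsFacet.ν∈K ν-facet)) (λ ¬D → ¬D refl))))

      W : MorseSequence L′
      W = proj₁ ih

      open IsGradient (proj₂ ih)

      filling : ElementaryFilling L′ L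
      filling = record { ν = value ν ; facet = ν-facet ; removal = id , id }

      exhaustive′ : ∀ {τ} → Simplex L (value τ) → (value τ ≡ value ν ⊎ IsCritical W (value τ)) ⊎
                    ∃₂ λ (α β : Face K) → IsRegularPair W (value α) (value β) × τ liesIn (α , β)
      exhaustive′ {τ} τ∈L with D? (value τ)
      ... | yes ν≡τ = inj₁ (inj₁ (sym ν≡τ))
      ... | no  ν≢τ = Sum.map₁ inj₂ (exhaustive (τ∈L , ν≢τ))
    ... | freePair σ τ free στ∈V = W ▷ inj₁ expansion , record
      { critical   = critical
      ; regular    =
          λ { (inj₁ (α≡σ , β≡τ)) → regular′ (value-injective α≡σ) (value-injective β≡τ)
            ; (inj₂ r) → regular r }
      ; exhaustive = exhaustive′
      }
      where
      upward : ∀ {α β} → (｛ value σ ｝ ∪ ｛ value τ ｝) α → Simplex L β → α ⊆ β →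
               (｛ value σ ｝ ∪ ｛ value τ ｝) β
      upward = freePair-upward free

      D? : Decidable (｛ value σ ｝ ∪ ｛ value τ ｝)
      D? ρ = (value σ ≟ˢ ρ) ⊎-dec (value τ ≟ˢ ρ)

      L′ : SimplicialComplex n
      L′ = remove L D? upward

      -- If `β` were `σ` or `τ`, `atMostOne` would identify the two pairs. In the first case `σ`
      -- equals `τ`, against irreflexivity; in the second `α` is `σ`, which was removed.
      not-removed : ∀ {α β} → Vf (α , β) → Simplex L′ (value α) →
                    ¬ (｛ value σ ｝ ∪ ｛ value τ ｝) (value β)
      not-removed {α} {β} v _ (inj₁ σ≡β) with refl ← value-injective {σ} {β} σ≡β
        with refl ← atMostOne f σ v στ∈V (inj₂ refl) (inj₁ refl) = V-irreflexive (map f) v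
      not-removed {α} {β} v (_ , ¬Dα) (inj₂ τ≡β) with refl ← value-injective {τ} {β} τ≡β
        with refl ← atMostOne f τ v στ∈V (inj₂ refl) (inj₂ refl) = ¬Dα (inj₁ refl)

      cl′ : PartnerClosed L′
      cl′ = record
        { inK   = PartnerClosed.inK cl ∘ proj₁
        ; upper = λ v α∈L′ → PartnerClosed.upper cl v (proj₁ α∈L′) , not-removed v α∈L′
        }

      ih : Σ[ W ∈ MorseSequence L′ ] IsGradient W
      ih = gradient-sequence cl′ (listing-remove D? upward l)
             (rec (filter-notAll (¬? ∘ D? ∘ value) xs
                    (lose (Listing.complete l {σ} (IsFreePair.σ∈K free)) (λ ¬D → ¬D (inj₁ refl)))))

      W : MorseSequence L′
      W = proj₁ ih

      open IsGradient (proj₂ ih)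

      expansion : ElementaryExpansion L′ L
      expansion = record { σ = value σ ; τ = value τ ; free = free ; removal = id , id }

      regular′ : ∀ {α β} → α ≡ σ → β ≡ τ → Vf (α , β)
      regular′ refl refl = στ∈V

      exhaustive′ : ∀ {ρ} → Simplex L (value ρ) → IsCritical W (value ρ) ⊎
                    ∃₂ λ (α β : Face K) → IsRegularPair (W ▷ inj₁ expansion) (value α) (value β) ×
                    ρ liesIn (α , β)
      exhaustive′ {ρ} ρ∈L with D? (value ρ)
      ... | yes D = inj₂ (σ , τ , inj₁ (refl , refl) ,
                          Sum.map (value-injective ∘ sym) (value-injective ∘ sym) D)
      ... | no ¬D = Sum.map₂ (λ (α , β , r , ρ∈αβ) → α , β , inj₂ r , ρ∈αβ) (exhaustive (ρ∈L , ¬D))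

    -- The Morse property and uniqueness of the gradient field.

    module _ {W : MorseSequence K} (W-gradient : IsGradient W) where
      open IsGradient W-gradient

      gradient⇒morseOn : IsMorseOn W (map f)
      gradient⇒morseOn = record
        { critical = λ κ ν c ν∈∂κ → ℤ.≰⇒> λ fκ≤fν → critical {ν} {κ} c (ν∈∂κ , fκ≤fν)
        ; regular  = λ σ τ r → proj₂ (regular {σ} {τ} r)
        }

      -- Each pair is traced through its upper face `τ`. A critical `τ` excludes the pair for both
      -- functions. Otherwise `τ` lies in a regular pair, which belongs to both fields and equals
      -- the given pair by `atMostOne`.
      gradient⇒equivalent : (g : MorseFunction K) → IsMorseOn W (map g) → Equivalent g f
      gradient⇒equivalent g g-on = Vg⊆Vf , Vf⊆Vg
        where
        regular∈Vg : ∀ {α β} → IsRegularPair W (value α) (value β) → V (map g) (α , β)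
        -- Incidence is independent of the function and comes from `Vf`; only the inequality is
        -- taken from g.
        regular∈Vg {α} {β} r = proj₁ (regular {α} {β} r) , IsMorseOn.regular g-on α β r

        Vg⊆Vf : ∀ {p} → V (map g) p → Vf p
        Vg⊆Vf {σ , τ} v with exhaustive {τ} (value∈ τ)
        ... | inj₁ c = contradiction (proj₂ v) (ℤ.<⇒≱ (IsMorseOn.critical g-on τ σ c (proj₁ v)))
        ... | inj₂ (α , β , r , τ∈αβ)
          with refl ← atMostOne g τ v (regular∈Vg {α} {β} r) (inj₂ refl) τ∈αβ = regular r

        Vf⊆Vg : ∀ {p} → Vf p → V (map g) p
        Vf⊆Vg {σ , τ} v with exhaustive {τ} (value∈ τ)
        ... | inj₁ c = contradiction v (critical c)
        ... | inj₂ (α , β , r , τ∈αβ)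
          with refl ← atMostOne f τ v (regular {α} {β} r) (inj₂ refl) τ∈αβ = regular∈Vg r

theorem15 : ∀ {n : ℕ} (K : SimplicialComplex n) (f : MorseFunction K) →
    Σ[ W ∈ MorseSequence K ]
    (IsMorseOn W (map f) ×
    (∀ (g : MorseFunction K) → IsMorseOn W (map g) → Equivalent g f))
theorem15 K f =
  let xs , l         = listing
      W , W-gradient = gradient-sequence f K-closed l (<-wellFounded (length xs))
  in W , gradient⇒morseOn f W-gradient , gradient⇒equivalent f W-gradient
  where
  K-closed : PartnerClosed f K
  K-closed = record { inK = id ; upper = λ {_} {τ} _ _ → value∈ τ }
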